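{- The following two statements are equivalent: (A) For every prime $p$, $p^2 \nmid u_{\gamma(p)}$. (B) For every integer $m \geq 2$: if $m^2 \mid u_{\gamma(m)}$, then $m \in \{6, 12\}$.
   Context: $(u_n)_{n\ge 0}$ is the Fibonacci sequence: $u_0=0$, $u_1=1$, $u_n=u_{n-1}+u_{n-2}$ for $n\ge 2$. For an integer $m\ge 1$, the period $\gamma(m)$ is the smallest positive integer $l$ with $u_l\equiv 0 \pmod m$ and $u_{l+1}\equiv 1 \pmod m$; equivalently, it is the order of the matrix $P=\begin{pmatrix}0&1\\1&1\end{pmatrix}$ in $\mathrm{GL}_2(\mathbb{Z}/m\mathbb{Z})$. -}

module Defs where

open import Data.Nat using (ℕ; zero; suc; _+_; _≤_; _<_)
open import Data.Nat.Divisibility using (_∣_)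
open import Data.Integer using (ℤ; +_; _-_)
import Data.Integer.Divisibility as ℤDiv
open import Data.Product using (_×_)
open import Relation.Nullary using (¬_)

u : ℕ → ℕ
u zero = 0
u (suc zero) = 1
u (suc (suc n)) = u (suc n) + u n

_≡_[mod_] : ℕ → ℕ → ℕ → Set
a ≡ b [mod m ] = (+ m) ℤDiv.∣ ((+ a) - (+ b))

PeriodCond : ℕ → ℕ → Set
PeriodCond m l = (u l ≡ 0 [mod m ]) × (u (suc l) ≡ 1 [mod m ])

IsPeriod : ℕ → ℕ → Set
IsPeriod m l = (1 ≤ l) × PeriodCond m l × (∀ k → 1 ≤ k → k < l → ¬ PeriodCond m k)

{-# OPTIONS --safe #-}

module Submission where

-- Let p be the largest prime factor of m = pᵉ k. For a prime q < p the rank of apparition n of q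
-- is at most q + 1 (pigeonhole on the ratios u (i+1) / u i modulo q) and 4 n is a period modulo q,
-- so for p > 3 the integer k has a period N prime to p. Hence γ(m) divides N pᵉ⁻¹ γ(p), and if
-- p² ∤ u_{γ(p)} then lifting the exponent shows that pᵉ⁺¹, a fortiori m², does not divide
-- u_{N pᵉ⁻¹ γ(p)}. For p ≤ 3 this fails, since γ(2) = 3 and lifting at 2 gains one
-- more factor; there m = 2ᵃ 3ᵇ and explicit periods leave m = 6 and m = 12.

open import Defs
open import Data.Nat using (ℕ; _≤_; _^_)
open import Data.Nat.Divisibility using (_∣_)
open import Data.Nat.Primality using (Prime)
open import Data.Sum using (_⊎_)
open import Relation.Nullary using (¬_)
open import Relation.Binary.PropositionalEquality using (_≡_)
open import Function.Bundles using (_⇔_)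

open import Data.Nat as ℕ using (zero; suc; _<_; z≤n; s≤s; NonZero)
import Data.Nat.Properties as ℕ
import Data.Nat.Divisibility as ℕ
import Data.Nat.DivMod as ℕ
open import Data.Nat.Induction using (<-rec)
open import Data.Nat.Coprimality using (Coprime; coprime-Bézout)
open import Data.Nat.GCD using (module Bézout)
open import Data.Nat.ListAction using (product)
open import Data.Nat.Primality using (prime?; prime⇒nonZero; prime⇒nonTrivial; prime⇒irreducible; prime[2]; euclidsLemma)
open import Data.Nat.Primality.Factorisation using (factorise)
open import Data.Integer as ℤ using (ℤ; +_; 0ℤ; 1ℤ)
import Data.Integer.Properties as ℤ
import Data.Integer.DivMod as ℤ
open import Data.Integer.Divisibility.Signed using (∣ᵤ⇒∣; ∣⇒∣ᵤ; ∣m∣n⇒∣m+n; ∣m∣n⇒∣m-n; ∣m⇒∣-m; ∣n⇒∣m*n; ∣m⇒∣m*n; divides) renaming (_∣_ to _∣ᶻ_)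
open import Data.Integer.Tactic.RingSolver using (solve-∀)
open import Data.Fin using (Fin; toℕ; fromℕ<)
import Data.Fin.Properties as Fin
open import Data.List using ([]; _∷_)
open import Data.List.Relation.Unary.All using (All; []; _∷_)
open import Data.Product using (∃; ∃-syntax; _×_; _,_; proj₁; proj₂)
open import Data.Sum using (inj₁; inj₂; [_,_]′)
open import Data.Empty using (⊥; ⊥-elim)
open import Function using (_∘_)
open import Function.Bundles using (mk⇔)
open import Relation.Nullary using (Dec; yes; no)
open import Relation.Nullary.Decidable using (_×-dec_; from-yes; from-no)
open import Relation.Binary.PropositionalEquality using (refl; sym; trans; cong; cong₂; subst; subst₂)

U : ℕ → ℤ
U n = + u n

-- The binomial coefficient j(j - 1)/2, kept free of division: the coefficient of X in the sum of (1
-- + X)ⁱ over i < j.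
tri : ℕ → ℕ
tri zero    = 0
tri (suc j) = tri j ℕ.+ j

-- PeriodCond with signed divisibility; a record so that m and s can be inferred.
record Per (m s : ℕ) : Set where
  constructor _,_
  field
    U≡0    : + m ∣ᶻ U s
    Usuc≡1 : + m ∣ᶻ U (suc s) ℤ.- 1ℤ

module Congruences where
  open import Data.Integer using (_+_; _*_; _-_; -_)

  -- Addition formulas and powers of φ modulo M.

  ∣-from-- : ∀ {k x y} → k ∣ᶻ x - y → k ∣ᶻ y → k ∣ᶻ x
  ∣-from-- {k} {x} {y} p q = subst (k ∣ᶻ_) (lemma x y) (∣m∣n⇒∣m+n p q)
    where
    lemma : ∀ x y → (x - y) + y ≡ x
    lemma = solve-∀

  *-pres-∣ᶻ : ∀ {a b x y} → a ∣ᶻ x → b ∣ᶻ y → a * b ∣ᶻ x * y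
  *-pres-∣ᶻ {a} {b} (divides q refl) (divides r refl) = divides (q * r) (lemma q a r b)
    where
    lemma : ∀ q a r b → (q * a) * (r * b) ≡ (q * r) * (a * b)
    lemma = solve-∀

  -- Both compare coefficients in φᵃ φᵇ, where φᵃ = (U (a+1) - U a) + U a φ. Writing the term before
  -- `U a` as a difference covers a = 0; the induction on a is joint.
  U-suc-+ : ∀ a b → U (suc (a ℕ.+ b)) ≡ U (suc a) * U (suc b) + U a * U b
  U-+     : ∀ a b → U (a ℕ.+ b) ≡ U a * U (suc b) + U (suc a) * U b - U a * U b

  U-suc-+ zero b = lemma (U (suc b)) (U b)
    where
    lemma : ∀ x y → x ≡ 1ℤ * x + 0ℤ * y
    lemma = solve-∀
  U-suc-+ (suc a) b =
    trans (cong₂ _+_ (U-suc-+ a b) (U-+ a b)) (lemma (U (suc a)) (U a) (U (suc b)) (U b))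
    where
    lemma : ∀ G F G′ F′ → (G * G′ + F * F′) + (F * G′ + G * F′ - F * F′) ≡ (G + F) * G′ + G * F′
    lemma = solve-∀

  U-+ zero b = lemma (U (suc b)) (U b)
    where
    lemma : ∀ x y → y ≡ 0ℤ * x + 1ℤ * y - 0ℤ * y
    lemma = solve-∀
  U-+ (suc a) b = trans (U-suc-+ a b) (lemma (U (suc a)) (U a) (U (suc b)) (U b))
    where
    lemma : ∀ G F G′ F′ → G * G′ + F * F′ ≡ G * G′ + (G + F) * F′ - G * F′
    lemma = solve-∀

  -- With φ the golden ratio and φˢ = 1 + X, the hypotheses say X² ≡ 0 (mod M), and then (1 + X)ʲ ≡ 1 + jX.
  module SquareZero (M : ℤ) (s : ℕ)
                    (FF : M ∣ᶻ U s * U s)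
                    (FH : M ∣ᶻ U s * (U (suc s) - 1ℤ))
                    (HH : M ∣ᶻ (U (suc s) - 1ℤ) * (U (suc s) - 1ℤ)) where

    private
      F = U s
      H = U (suc s) - 1ℤ

    U-linear     : ∀ j → M ∣ᶻ U (j ℕ.* s) - + j * F
    U-suc-linear : ∀ j → M ∣ᶻ U (suc (j ℕ.* s)) - 1ℤ - + j * H

    U-linear zero = divides 0ℤ (lemma F)
      where
      lemma : ∀ F → 0ℤ - 0ℤ * F ≡ 0ℤ
      lemma = solve-∀
    -- With E the inductive error, (1 + X)(1 + jX + E) - (1 + (j + 1)X) = jX² + (1 + X)E. The two
    -- lines below are the coefficients of φ in jX² and in (1 + X)E.
    U-linear (suc j) = subst (M ∣ᶻ_) eq
      (∣m∣n⇒∣m+n (∣m∣n⇒∣m-n (∣n⇒∣m*n (+ j + + j) FH) (∣n⇒∣m*n (+ j) FF))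
                 (∣m∣n⇒∣m+n (∣n⇒∣m*n F (U-suc-linear j)) (∣n⇒∣m*n (U (suc s) - F) (U-linear j))))
      where
      lemma : ∀ F G F′ G′ j →
        ((j + j) * (F * (G - 1ℤ)) - j * (F * F)) + (F * (G′ - 1ℤ - j * (G - 1ℤ)) + (G - F) * (F′ - j * F))
        ≡ (F * G′ + G * F′ - F * F′) - (1ℤ + j) * F
      lemma = solve-∀
      eq = trans (lemma F (U (suc s)) (U (j ℕ.* s)) (U (suc (j ℕ.* s))) (+ j))
                 (cong (_- + suc j * F) (sym (U-+ s (j ℕ.* s))))

    U-suc-linear zero = divides 0ℤ (lemma H)
      where
      lemma : ∀ H → 1ℤ - 1ℤ - 0ℤ * H ≡ 0ℤ
      lemma = solve-∀
    U-suc-linear (suc j) = subst (M ∣ᶻ_) eq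
      (∣m∣n⇒∣m+n (∣m∣n⇒∣m+n (∣n⇒∣m*n (+ j) HH) (∣n⇒∣m*n (+ j) FF))
                 (∣m∣n⇒∣m+n (∣n⇒∣m*n (U (suc s)) (U-suc-linear j)) (∣n⇒∣m*n F (U-linear j))))
      where
      lemma : ∀ F G F′ G′ j →
        (j * ((G - 1ℤ) * (G - 1ℤ)) + j * (F * F)) + (G * (G′ - 1ℤ - j * (G - 1ℤ)) + F * (F′ - j * F))
        ≡ (G * G′ + F * F′) - 1ℤ - (1ℤ + j) * (G - 1ℤ)
      lemma = solve-∀
      eq = trans (lemma F (U (suc s)) (U (j ℕ.* s)) (U (suc (j ℕ.* s))) (+ j))
                 (cong (λ x → x - 1ℤ - + suc j * H) (sym (U-suc-+ s (j ℕ.* s))))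

  -- Arithmetic of periods.

  per-multiple : ∀ {m s} j → Per m s → Per m (j ℕ.* s)
  per-multiple {m} {s} j (pF , pH) =
    ∣-from-- (U-linear j) (∣n⇒∣m*n (+ j) pF) , ∣-from-- (U-suc-linear j) (∣n⇒∣m*n (+ j) pH)
    where
    open SquareZero (+ m) s (∣n⇒∣m*n (U s) pF) (∣n⇒∣m*n (U s) pH) (∣n⇒∣m*n (U (suc s) - 1ℤ) pH)

  -- X is divisible by q and by k, hence X² by q k; so (1 + X)^q ≡ 1 + qX, and q k divides qX. Since
  -- q and k may share factors, this also climbs prime powers.
  per-* : ∀ {q k s} → Per q s → Per k s → Per (q ℕ.* k) (q ℕ.* s)
  per-* {q} {k} {s} (qF , qH) (kF , kH) =
      ∣-from-- (U-linear q) (qk (*-pres-∣ᶻ (divides 1ℤ (sym (ℤ.*-identityˡ (+ q)))) kF))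
    , ∣-from-- (U-suc-linear q) (qk (*-pres-∣ᶻ (divides 1ℤ (sym (ℤ.*-identityˡ (+ q)))) kH))
    where
    qk : ∀ {x} → + q * + k ∣ᶻ x → + (q ℕ.* k) ∣ᶻ x
    qk {x} = subst (_∣ᶻ x) (sym (ℤ.pos-* q k))
    open SquareZero (+ (q ℕ.* k)) s
      (qk (*-pres-∣ᶻ qF kF)) (qk (*-pres-∣ᶻ qF kH)) (qk (*-pres-∣ᶻ qH kH))

  -- φʳ ≡ φʳ φˢ because φˢ ≡ 1; this serves the division with remainder in `period-∣`.
  per-remainder : ∀ {m r s} → Per m s → Per m (r ℕ.+ s) → Per m r
  per-remainder {m} {r} {s} (pF , pH) (qF , qH) =
      subst (+ m ∣ᶻ_) (lemma (U r) (U (suc r)) (U s) (U (suc s)))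
        (∣m∣n⇒∣m-n (subst (+ m ∣ᶻ_) (U-+ r s) qF)
                   (∣m∣n⇒∣m+n (∣n⇒∣m*n (U r) pH) (∣n⇒∣m*n (U (suc r) - U r) pF)))
    , subst (+ m ∣ᶻ_) (lemma′ (U r) (U (suc r)) (U s) (U (suc s)))
        (∣m∣n⇒∣m-n (subst (λ x → + m ∣ᶻ x - 1ℤ) (U-suc-+ r s) qH)
                   (∣m∣n⇒∣m+n (∣n⇒∣m*n (U (suc r)) pH) (∣n⇒∣m*n (U r) pF)))
    where
    lemma : ∀ F G F′ G′ → (F * G′ + G * F′ - F * F′) - (F * (G′ - 1ℤ) + (G - F) * F′) ≡ F
    lemma = solve-∀
    lemma′ : ∀ F G F′ G′ → ((G * G′ + F * F′) - 1ℤ) - (G * (G′ - 1ℤ) + F * F′) ≡ G - 1ℤ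
    lemma′ = solve-∀

  -- The quotient of u (j s) by u s.

  -- U (j * s) / U s, by a recursion that also makes sense when U s = 0.
  cofactor : ℕ → ℕ → ℤ
  cofactor s zero    = 0ℤ
  cofactor s (suc j) = cofactor s j * (U (suc s) - U s) + U (suc (j ℕ.* s))

  U-cofactor : ∀ s j → U (j ℕ.* s) ≡ U s * cofactor s j
  U-cofactor s zero    = sym (ℤ.*-zeroʳ (U s))
  U-cofactor s (suc j) = trans (U-+ s (j ℕ.* s))
    (trans (cong (λ x → U s * G′ + U (suc s) * x - U s * x) (U-cofactor s j))
           (lemma (U s) (U (suc s)) G′ (cofactor s j)))
    where
    G′ = U (suc (j ℕ.* s))
    lemma : ∀ F G G′ w → F * G′ + G * (F * w) - F * (F * w) ≡ F * (w * (G - F) + G′)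
    lemma = solve-∀

  u∣u* : ∀ s j → u s ∣ u (j ℕ.* s)
  u∣u* s j = ∣⇒∣ᵤ (divides (cofactor s j) (trans (U-cofactor s j) (ℤ.*-comm (U s) (cofactor s j))))

  u-cofactor : ∀ s j → u (j ℕ.* s) ≡ u s ℕ.* ℤ.∣ cofactor s j ∣
  u-cofactor s j = trans (cong ℤ.∣_∣ (U-cofactor s j)) (ℤ.abs-* (U s) (cofactor s j))

  -- The cofactor is the sum of αⁱ βʲ⁻¹⁻ⁱ over i < j, with α = φˢ and β its conjugate; modulo m both
  -- are 1.
  cofactor-mod : ∀ {m s} → Per m s → ∀ j → + m ∣ᶻ cofactor s j - + j
  cofactor-mod _ zero = divides 0ℤ refl
  cofactor-mod {m} {s} per@(pF , pH) (suc j) =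
    subst (+ m ∣ᶻ_) (lemma (U s) (U (suc s)) (U (suc (j ℕ.* s))) (cofactor s j) (+ j))
      (∣m∣n⇒∣m+n (cofactor-mod per j)
        (∣m∣n⇒∣m+n (∣n⇒∣m*n (cofactor s j) (∣m∣n⇒∣m-n pH pF)) (Per.Usuc≡1 (per-multiple j per))))
    where
    lemma : ∀ F G G′ w j → (w - j) + (w * ((G - 1ℤ) - F) + (G′ - 1ℤ)) ≡ (w * (G - F) + G′) - (1ℤ + j)
    lemma = solve-∀

  -- With φˢ = 1 + X as above, this is the first-order expansion in X of the cofactor.
  cofactor-mod-square : ∀ {p s} → Per p s → ∀ j → let F = U s; H = U (suc s) - 1ℤ in
    + p * + p ∣ᶻ cofactor s j - (+ j + + tri j * (H + H - F))
  cofactor-mod-square {p} {s} (pF , pH) = go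
    where
    F = U s
    H = U (suc s) - 1ℤ
    M = + p * + p
    open SquareZero M s (*-pres-∣ᶻ pF pF) (*-pres-∣ᶻ pF pH) (*-pres-∣ᶻ pH pH)
    lemma₀ : ∀ c → 0ℤ - (0ℤ + 0ℤ * c) ≡ 0ℤ
    lemma₀ = solve-∀
    lemma : ∀ F G G′ w j t → let H = G - 1ℤ in
      ((w - (j + t * (H + H - F))) * (G - F) + (G′ - 1ℤ - j * H)) + t * ((H + H - F) * (H - F))
      ≡ (w * (G - F) + G′) - ((1ℤ + j) + (t + j) * (H + H - F))
    lemma = solve-∀
    go : ∀ j → M ∣ᶻ cofactor s j - (+ j + + tri j * (H + H - F))
    go zero    = divides 0ℤ (lemma₀ (H + H - F))
    go (suc j) = subst (M ∣ᶻ_)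
      (lemma F (U (suc s)) (U (suc (j ℕ.* s))) (cofactor s j) (+ j) (+ tri j))
      (∣m∣n⇒∣m+n (∣m∣n⇒∣m+n (∣m⇒∣m*n (U (suc s) - F) (go j)) (U-suc-linear j))
        (∣n⇒∣m*n (+ tri j)
          (*-pres-∣ᶻ (∣m∣n⇒∣m-n (∣m∣n⇒∣m+n pH pH) pF) (∣m∣n⇒∣m-n pH pF))))

  -- Rank of apparition modulo a prime.

  -- u (i+1) u (i+d) − u (i+d+1) u i = (−1)ⁱ u d.
  d'Ocagne : ∀ {M} i d → M ∣ᶻ U (suc i) * U (i ℕ.+ d) - U (suc (i ℕ.+ d)) * U i → M ∣ᶻ U d
  d'Ocagne {M} zero d h = subst (M ∣ᶻ_) (lemma (U d) (U (suc d))) h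
    where
    lemma : ∀ x y → 1ℤ * x - y * 0ℤ ≡ x
    lemma = solve-∀
  d'Ocagne {M} (suc i) d h = d'Ocagne i d
    (subst (M ∣ᶻ_) (lemma (U (suc i)) (U i) (U (suc (i ℕ.+ d))) (U (i ℕ.+ d))) (∣m⇒∣-m h))
    where
    lemma : ∀ a b c d → - ((a + b) * c - (c + d) * a) ≡ a * d - c * b
    lemma = solve-∀

  -- `N` is the norm (-1)ⁿ of φⁿ; squaring it removes the parity of n from the induction.
  cassini² : ∀ n → let F = U n; G = U (suc n); N = G * G - G * F - F * F in N * N ≡ 1ℤ
  cassini² zero    = refl
  cassini² (suc n) = trans (lemma (U n) (U (suc n))) (cassini² n)
    where
    lemma : ∀ F G →
      ((G + F) * (G + F) - (G + F) * G - G * G) * ((G + F) * (G + F) - (G + F) * G - G * G)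
      ≡ (G * G - G * F - F * F) * (G * G - G * F - F * F)
    lemma = solve-∀

  -- If M divides `U n`, then φⁿ is congruent to the scalar `U (suc n)`, and its powers are powers
  -- of that scalar.
  U-suc-scalar : ∀ {M} n → M ∣ᶻ U n → ∀ j → M ∣ᶻ U (suc (j ℕ.* n)) - U (suc n) ℤ.^ j
  U-suc-scalar n h zero    = divides 0ℤ refl
  U-suc-scalar {M} n h (suc j) =
    subst (M ∣ᶻ_) eq (∣m∣n⇒∣m+n (∣n⇒∣m*n (U (suc n)) (U-suc-scalar n h j)) (∣m⇒∣m*n (U (j ℕ.* n)) h))
    where
    lemma : ∀ F G F′ G′ x → G * (G′ - x) + F * F′ ≡ (G * G′ + F * F′) - G * x
    lemma = solve-∀
    eq = trans (lemma (U n) (U (suc n)) (U (j ℕ.* n)) (U (suc (j ℕ.* n))) (U (suc n) ℤ.^ j))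
               (cong (_- U (suc n) * U (suc n) ℤ.^ j) (sym (U-suc-+ n (j ℕ.* n))))

  -- Modulo q the power φⁿ is a scalar whose square is its norm ±1.
  ∣u⇒per-4* : ∀ {q} n → q ∣ u n → Per q (4 ℕ.* n)
  ∣u⇒per-4* {q} n q∣un =
      ∣ᵤ⇒∣ (ℕ.∣-trans q∣un (u∣u* n 4))
    , subst (+ q ∣ᶻ_) eq
        -- The long factor is (G⁴ - N²) / F for the norm N = G² - GF - F², so adding F times it
        -- replaces G⁴ by N² = 1.
        (∣m∣n⇒∣m+n (U-suc-scalar n h 4) (∣m⇒∣m*n ((G * G + G * G) * (G + F) - F * ((G + F) * (G + F))) h))
    where
    F = U n
    G = U (suc n)
    h : + q ∣ᶻ F
    h = ∣ᵤ⇒∣ q∣un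
    lemma : ∀ x F G →
      (x - G * (G * (G * (G * 1ℤ)))) + F * ((G * G + G * G) * (G + F) - F * ((G + F) * (G + F)))
      ≡ x - (G * G - G * F - F * F) * (G * G - G * F - F * F)
    lemma = solve-∀
    eq = trans (lemma (U (suc (4 ℕ.* n))) F G) (cong (λ z → U (suc (4 ℕ.* n)) - z) (cassini² n))

  -- Clears denominators: `c₁` and `c₂` are inverses of `a₁` and `a₂`, so the last hypothesis
  -- equates two fractions.
  cross-ratio : ∀ {M} a₁ b₁ c₁ a₂ b₂ c₂ → M ∣ᶻ a₁ * c₁ - 1ℤ → M ∣ᶻ a₂ * c₂ - 1ℤ →
    M ∣ᶻ b₁ * c₁ - b₂ * c₂ → M ∣ᶻ b₁ * a₂ - b₂ * a₁
  cross-ratio {M} a₁ b₁ c₁ a₂ b₂ c₂ h₁ h₂ h = subst (M ∣ᶻ_) (lemma a₁ b₁ c₁ a₂ b₂ c₂)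
    (∣m∣n⇒∣m+n (∣m∣n⇒∣m-n (∣n⇒∣m*n (a₁ * a₂) h) (∣n⇒∣m*n (b₁ * a₂) h₁)) (∣n⇒∣m*n (b₂ * a₁) h₂))
    where
    lemma : ∀ a₁ b₁ c₁ a₂ b₂ c₂ →
      ((a₁ * a₂) * (b₁ * c₁ - b₂ * c₂) - (b₁ * a₂) * (a₁ * c₁ - 1ℤ)) + (b₂ * a₁) * (a₂ * c₂ - 1ℤ)
      ≡ b₁ * a₂ - b₂ * a₁
    lemma = solve-∀

  %ℕ-≡⇒∣- : ∀ x y q .{{_ : NonZero q}} → x ℤ.%ℕ q ≡ y ℤ.%ℕ q → + q ∣ᶻ x - y
  %ℕ-≡⇒∣- x y q eq = divides (x ℤ./ℕ q - y ℤ./ℕ q)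
    (trans (cong₂ _-_ (ℤ.a≡a%ℕn+[a/ℕn]*n x q)
                      (trans (ℤ.a≡a%ℕn+[a/ℕn]*n y q) (cong (λ r → + r + (y ℤ./ℕ q) * + q) (sym eq))))
           (lemma (+ (x ℤ.%ℕ q)) (x ℤ./ℕ q) (y ℤ./ℕ q) (+ q)))
    where
    lemma : ∀ r a b q → (r + a * q) - (r + b * q) ≡ (a - b) * q
    lemma = solve-∀

  prime-inverse : ∀ {q a} → Prime q → ¬ (q ∣ a) → ∃[ c ] (+ q ∣ᶻ + a * c - 1ℤ)
  prime-inverse {q} {a} pq q∤a with coprime-Bézout {q} {a} coprime
    where
    coprime : Coprime q a
    coprime (d∣q , d∣a) with prime⇒irreducible pq d∣q
    ... | inj₁ d≡1  = d≡1
    ... | inj₂ refl = ⊥-elim (q∤a d∣a)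
  ... | Bézout.+- x y eq = - (+ y) , divides (- (+ x))
    (trans (lemma (+ a) (+ y)) (trans (cong -_ eqᶻ) (ℤ.neg-distribˡ-* (+ x) (+ q))))
    where
    lemma : ∀ a y → a * - y - 1ℤ ≡ - (1ℤ + y * a)
    lemma = solve-∀
    eqᶻ : 1ℤ + + y * + a ≡ + x * + q
    eqᶻ = trans (cong (λ z → 1ℤ + z) (sym (ℤ.pos-* y a))) (trans (cong +_ eq) (ℤ.pos-* x q))
  ... | Bézout.-+ x y eq = + y , divides (+ x)
    (trans (cong (_- 1ℤ) (trans (ℤ.*-comm (+ a) (+ y)) (sym eqᶻ))) (lemma (+ x * + q)))
    where
    lemma : ∀ z → (1ℤ + z) - 1ℤ ≡ z
    lemma = solve-∀
    eqᶻ : 1ℤ + + x * + q ≡ + y * + a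
    eqᶻ = trans (cong (λ z → 1ℤ + z) (sym (ℤ.pos-* x q))) (trans (cong +_ eq) (ℤ.pos-* y a))

  -- The ratios u (n+1) / u n take at most q values modulo q, and by d'Ocagne's
  -- identity two equal ratios at distance d force q ∣ u d.
  rank-bound : ∀ {q} → Prime q → ∃[ n ] (1 ≤ n × n ≤ suc q × q ∣ u n)
  rank-bound {q} pq with Fin.any? {suc q} (λ i → q ℕ.∣? u (suc (toℕ i)))
  ... | yes (i , h) = suc (toℕ i) , s≤s z≤n , Fin.toℕ<n i , h
  ... | no  none    = d , ℕ.m<n⇒0<n∸m i<j
                        , ℕ.≤-trans (ℕ.m∸n≤m (toℕ j) (toℕ i)) (ℕ.<⇒≤ (Fin.toℕ<n j))
                        , ∣⇒∣ᵤ (d'Ocagne (suc (toℕ i)) d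
                            (subst (λ k → + q ∣ᶻ U (2 ℕ.+ toℕ i) * U (suc k) - U (2 ℕ.+ k) * U (suc (toℕ i)))
                                   (sym (ℕ.m+[n∸m]≡n (ℕ.<⇒≤ i<j))) cross))
    where
    instance _ = prime⇒nonZero pq
    inverse : ∀ (i : Fin (suc q)) → ∃[ c ] (+ q ∣ᶻ U (suc (toℕ i)) * c - 1ℤ)
    inverse i = prime-inverse pq (λ h → none (i , h))
    ratio : Fin (suc q) → ℤ
    ratio i = U (2 ℕ.+ toℕ i) * proj₁ (inverse i)
    residue : Fin (suc q) → Fin q
    residue i = fromℕ< (ℤ.n%ℕd<d (ratio i) q)
    collision = Fin.pigeonhole (ℕ.n<1+n q) residue
    i = proj₁ collision
    j = proj₁ (proj₂ collision)
    i<j = proj₁ (proj₂ (proj₂ collision))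
    d = toℕ j ℕ.∸ toℕ i
    same : ratio i ℤ.%ℕ q ≡ ratio j ℤ.%ℕ q
    same = Fin.fromℕ<-injective _ _ _ _ (proj₂ (proj₂ (proj₂ collision)))
    cross : + q ∣ᶻ U (2 ℕ.+ toℕ i) * U (suc (toℕ j)) - U (2 ℕ.+ toℕ j) * U (suc (toℕ i))
    cross = cross-ratio (U (suc (toℕ i))) (U (2 ℕ.+ toℕ i)) (proj₁ (inverse i))
      (U (suc (toℕ j))) (U (2 ℕ.+ toℕ j)) (proj₁ (inverse j))
      (proj₂ (inverse i)) (proj₂ (inverse j)) (%ℕ-≡⇒∣- (ratio i) (ratio j) q same)

  -- The factor gained when the index is multiplied by p.

  tri-double : ∀ j → + 2 * + tri j + + j ≡ + j * + j
  tri-double zero    = refl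
  tri-double (suc j) = trans (lemma (+ tri j) (+ j))
    (trans (cong (λ z → z + (1ℤ + + j + + j)) (tri-double j)) (lemma′ (+ j)))
    where
    lemma : ∀ t j → + 2 * (t + j) + (1ℤ + j) ≡ (+ 2 * t + j) + (1ℤ + j + j)
    lemma = solve-∀
    lemma′ : ∀ j → j * j + (1ℤ + j + j) ≡ (1ℤ + j) * (1ℤ + j)
    lemma′ = solve-∀

  2tri+j≡j² : ∀ j → 2 ℕ.* tri j ℕ.+ j ≡ j ℕ.* j
  2tri+j≡j² j = ℤ.+-injective (trans (cong (λ z → z + + j) (ℤ.pos-* 2 (tri j)))
    (trans (tri-double j) (sym (ℤ.pos-* j j))))

  -- In the first-order expansion p divides both the coefficient `tri p` and the trace 2H - F of X,
  -- so the linear term vanishes modulo p².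
  cofactor-odd : ∀ {p s} → p ∣ tri p → Per p s → + p * + p ∣ᶻ cofactor s p - + p
  cofactor-odd {p} {s} p∣tri per@(pF , pH) =
    ∣-from-- (subst (+ p * + p ∣ᶻ_) (lemma (cofactor s p) (+ p) X) (cofactor-mod-square per p))
             (*-pres-∣ᶻ {+ p} {+ p} {+ tri p} (∣ᵤ⇒∣ p∣tri) (∣m∣n⇒∣m-n (∣m∣n⇒∣m+n pH pH) pF))
    where
    X = + tri p * ((U (suc s) - 1ℤ) + (U (suc s) - 1ℤ) - U s)
    lemma : ∀ w p x → w - (p + x) ≡ (w - p) - x
    lemma = solve-∀

  -- As `tri 2` is 1, the trace 2H - F must itself be divisible by 4: H is even, and `4 ∣ u s`
  -- handles F.
  cofactor-two : ∀ {s} → Per 2 s → 4 ∣ u s → + 2 * + 2 ∣ᶻ cofactor s 2 - + 2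
  cofactor-two {s} per@(pF , divides h eq) 4∣us =
    ∣-from-- (subst (+ 4 ∣ᶻ_) (lemma (cofactor s 2) (+ 2) X) (cofactor-mod-square per 2))
             (subst (+ 4 ∣ᶻ_) (lemma′ (H + H - U s))
               (∣m∣n⇒∣m-n (divides h (trans (cong₂ _+_ eq eq) (lemma″ h))) (∣ᵤ⇒∣ 4∣us)))
    where
    H = U (suc s) - 1ℤ
    X = 1ℤ * (H + H - U s)
    lemma : ∀ w p x → w - (p + x) ≡ (w - p) - x
    lemma = solve-∀
    lemma′ : ∀ x → x ≡ 1ℤ * x
    lemma′ = solve-∀
    lemma″ : ∀ h → h * + 2 + h * + 2 ≡ h * + 4
    lemma″ = solve-∀

  -- The cofactor is p (1 + c p), and 1 + c p is prime to p: for prime p exactly one factor p is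
  -- gained.
  u-prime-multiple : ∀ {p s} → + p * + p ∣ᶻ cofactor s p - + p →
    ∃[ w ] (u (p ℕ.* s) ≡ p ℕ.* (u s ℕ.* w) × (p ∣ w → p ∣ 1))
  u-prime-multiple {p} {s} (divides c eq) = ℤ.∣ x ∣ , factored , λ p∣w →
      ∣⇒∣ᵤ (subst (+ p ∣ᶻ_) (lemma₃ (c * + p))
        (∣m∣n⇒∣m-n {m = x} (∣ᵤ⇒∣ p∣w) (∣n⇒∣m*n c (divides 1ℤ (sym (ℤ.*-identityˡ (+ p)))))))
    where
    x = 1ℤ + c * + p
    lemma₁ : ∀ w p → w ≡ (w - p) + p
    lemma₁ = solve-∀
    lemma₂ : ∀ F c p → F * (c * (p * p) + p) ≡ p * (F * (1ℤ + c * p))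
    lemma₂ = solve-∀
    lemma₃ : ∀ z → (1ℤ + z) - z ≡ 1ℤ
    lemma₃ = solve-∀
    factored : u (p ℕ.* s) ≡ p ℕ.* (u s ℕ.* ℤ.∣ x ∣)
    factored = trans (cong ℤ.∣_∣ (trans (U-cofactor s p)
        (trans (cong (U s *_) (trans (lemma₁ (cofactor s p) (+ p)) (cong (_+ + p) eq))) (lemma₂ (U s) c (+ p)))))
      (trans (ℤ.abs-* (+ p) (U s * x)) (cong (p ℕ.*_) (ℤ.abs-* (U s) x)))

  cofactor-∤ : ∀ {p s N} → Per p s → ¬ (p ∣ N) → ¬ (p ∣ ℤ.∣ cofactor s N ∣)
  cofactor-∤ {p} {s} {N} per p∤N p∣w = p∤N (∣⇒∣ᵤ (subst (+ p ∣ᶻ_) (lemma (cofactor s N) (+ N))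
      (∣m∣n⇒∣m-n {m = cofactor s N} (∣ᵤ⇒∣ p∣w) (cofactor-mod per N))))
    where
    lemma : ∀ w n → w - (w - n) ≡ n
    lemma = solve-∀

open Congruences
open import Data.Nat using (_+_; _*_; _≤?_)
open import Data.Nat.Divisibility using (_∣?_; ∣-trans)
import Data.Nat.Tactic.RingSolver as ℕRing

-- Elementary facts on primes.

prime≥2 : ∀ {p} → Prime p → 2 ≤ p
prime≥2 pp = ℕ.nonTrivial⇒n>1 _ {{prime⇒nonTrivial pp}}

prime∤1 : ∀ {p} → Prime p → ¬ (p ∣ 1)
prime∤1 pp p∣1 = ℕ.<⇒≱ (prime≥2 pp) (ℕ.∣⇒≤ p∣1)

prime-∣-prime : ∀ {p q} → Prime p → Prime q → p ∣ q → p ≡ q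
prime-∣-prime pp pq p∣q with prime⇒irreducible pq p∣q
... | inj₁ refl = ⊥-elim (prime∤1 pp ℕ.∣-refl)
... | inj₂ eq   = eq

prime-∣-power : ∀ {p} a j → Prime p → p ∣ a ^ j → p ∣ a
prime-∣-power a zero    pp h = ⊥-elim (prime∤1 pp h)
prime-∣-power a (suc j) pp h = [ (λ z → z) , prime-∣-power a j pp ]′ (euclidsLemma a (a ^ j) pp h)

power-∣-cancel : ∀ {p f w} → Prime p → ¬ (p ∣ w) → ∀ j → p ^ j ∣ f * w → p ^ j ∣ f
power-∣-cancel {p} {f} {w} pp p∤w zero    h = ℕ.1∣ f
power-∣-cancel {p} {f} {w} pp p∤w (suc j) h
  with euclidsLemma f w pp (ℕ.m*n∣⇒m∣ p (p ^ j) h)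
... | inj₂ p∣w = ⊥-elim (p∤w p∣w)
... | inj₁ (ℕ.divides f′ refl) = subst (p * p ^ j ∣_) (ℕ.*-comm p f′)
    (ℕ.*-monoʳ-∣ p (power-∣-cancel pp p∤w j (ℕ.*-cancelˡ-∣ p (subst (p * p ^ j ∣_) rearrange h))))
  where
  instance _ = prime⇒nonZero pp
  rearrange : f′ * p * w ≡ p * (f′ * w)
  rearrange = trans (cong (_* w) (ℕ.*-comm f′ p)) (ℕ.*-assoc p f′ w)

split-power : ∀ {p} → 2 ≤ p → ∀ m → 1 ≤ m → ∃[ e ] ∃[ k ] (m ≡ p ^ e * k × ¬ (p ∣ k))
split-power {p} 2≤p = <-rec _ step
  where
  step : ∀ m → (∀ {n} → n < m → 1 ≤ n → ∃[ e ] ∃[ k ] (n ≡ p ^ e * k × ¬ (p ∣ k))) →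
         1 ≤ m → ∃[ e ] ∃[ k ] (m ≡ p ^ e * k × ¬ (p ∣ k))
  step m rec 1≤m with p ∣? m
  ... | no  p∤m = 0 , m , sym (ℕ.*-identityˡ m) , p∤m
  ... | yes (ℕ.divides zero refl) = ⊥-elim (ℕ.<⇒≱ 1≤m z≤n)
  ... | yes (ℕ.divides n@(suc _) refl) with rec (ℕ.m<m*n n p 2≤p) (s≤s z≤n)
  ... | e , k , eq , p∤k = suc e , k
    , trans (ℕ.*-comm n p) (trans (cong (p *_) eq) (sym (ℕ.*-assoc p (p ^ e) k))) , p∤k

prime-divisor : ∀ m → 1 ≤ m → m ≡ 1 ⊎ ∃[ p ] (Prime p × p ∣ m)
prime-divisor m@(suc _) _ with factorise m
... | record { factors = []     ; isFactorisation = eq } = inj₁ eq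
... | record { factors = p ∷ ps ; isFactorisation = eq ; factorsPrime = pp ∷ _ } =
  inj₂ (p , pp , subst (p ∣_) (sym eq) (ℕ.m∣m*n (product ps)))

IsLargestPrimeDivisor : ℕ → ℕ → Set
IsLargestPrimeDivisor m p = Prime p × p ∣ m × (∀ q → Prime q → q ∣ m → q ≤ p)

largest-prime-divisor : ∀ m → 2 ≤ m → ∃ (IsLargestPrimeDivisor m)
largest-prime-divisor m@(suc _) 2≤m with prime-divisor m (s≤s z≤n)
... | inj₁ refl = ⊥-elim (ℕ.<-irrefl refl 2≤m)
... | inj₂ (p , pp , p∣m) = search (suc m) (λ q _ q∣m → s≤s (ℕ.∣⇒≤ q∣m))
  where
  search : ∀ B → (∀ q → Prime q → q ∣ m → q < B) → ∃ (IsLargestPrimeDivisor m)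
  search zero    bound with () ← bound p pp p∣m
  search (suc B) bound with prime? B ×-dec (B ∣? m)
  ... | yes (pB , B∣m) = B , pB , B∣m , λ q pq q∣m → ℕ.s≤s⁻¹ (bound q pq q∣m)
  ... | no  ¬B = search B λ q pq q∣m →
    ℕ.≤∧≢⇒< (ℕ.s≤s⁻¹ (bound q pq q∣m)) λ { refl → ¬B (pq , q∣m) }

-- The product q (q + 1) = 2 (`tri q` + q) is even, so 2 equals one of the two primes; q + 1 = 2
-- would make q = 1.
consecutive-primes : ∀ {q} → Prime q → Prime (suc q) → q ≡ 2
consecutive-primes {q} pq pq′ with euclidsLemma (suc q) q prime[2] 2∣
  where
  2∣ : 2 ∣ suc q * q
  2∣ = ℕ.divides (tri q + q) (trans (cong (λ x → q + x) (sym (2tri+j≡j² q))) (rearrange q (tri q)))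
    where
    rearrange : ∀ q t → q + (2 * t + q) ≡ (t + q) * 2
    rearrange = ℕRing.solve-∀
... | inj₁ h with refl ← prime-∣-prime prime[2] pq′ h = ⊥-elim (prime∤1 pq ℕ.∣-refl)
... | inj₂ h = sym (prime-∣-prime prime[2] pq h)

prime-∣-tri : ∀ {p} → Prime p → 2 < p → p ∣ tri p
prime-∣-tri {p} pp 2<p with euclidsLemma 2 (tri p) pp
  (ℕ.∣m+n∣m⇒∣n (subst (p ∣_) (trans (sym (2tri+j≡j² p)) (ℕ.+-comm (2 * tri p) p)) (ℕ.m∣m*n p)) ℕ.∣-refl)
... | inj₁ p∣2 = ⊥-elim (ℕ.<⇒≱ 2<p (ℕ.∣⇒≤ p∣2))
... | inj₂ h   = h

-- Least periods and periods for composite moduli.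

periodCond⇒per : ∀ {m l} → PeriodCond m l → Per m l
-- The absolute value of `+ u l - + 0` computes to `u l + 0`.
periodCond⇒per {m} {l} (h , h′) = ∣ᵤ⇒∣ (subst (m ∣_) (ℕ.+-identityʳ (u l)) h) , ∣ᵤ⇒∣ h′

per⇒periodCond : ∀ {m l} → Per m l → PeriodCond m l
per⇒periodCond {m} {l} (h , h′) = subst (m ∣_) (sym (ℕ.+-identityʳ (u l))) (∣⇒∣ᵤ h) , ∣⇒∣ᵤ h′

periodCond? : ∀ m l → Dec (PeriodCond m l)
periodCond? m l = (m ∣? _) ×-dec (m ∣? _)

per-∣ : ∀ {d m s} → d ∣ m → Per m s → Per d s
per-∣ d∣m (h , h′) = ∣ᵤ⇒∣ (∣-trans d∣m (∣⇒∣ᵤ h)) , ∣ᵤ⇒∣ (∣-trans d∣m (∣⇒∣ᵤ h′))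

-- Statement (A) speaks only of least periods, so one must be produced from a known period before
-- (A) applies.
least-period : ∀ {m t} → 1 ≤ t → PeriodCond m t → ∃ (IsPeriod m)
least-period {m} {t} 1≤t pc with search (suc t)
  where
  search : ∀ B → ∃ (IsPeriod m) ⊎ (∀ k → 1 ≤ k → k < B → ¬ PeriodCond m k)
  search zero = inj₂ λ _ _ ()
  search (suc B) with search B
  ... | inj₁ found = inj₁ found
  ... | inj₂ none with (1 ≤? B) ×-dec periodCond? m B
  ...   | yes (1≤B , pcB) = inj₁ (B , 1≤B , pcB , none)
  ...   | no  ¬B = inj₂ λ k 1≤k k<1+B pck → none k 1≤k
      (ℕ.≤∧≢⇒< (ℕ.s≤s⁻¹ k<1+B) λ { refl → ¬B (1≤k , pck) }) pck
... | inj₁ found = found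
... | inj₂ none  = ⊥-elim (none t 1≤t ℕ.≤-refl pc)

-- The remainder of L by l would be a period shorter than l.
period-∣ : ∀ {m l L} → IsPeriod m l → Per m L → l ∣ L
period-∣ {m} {l@(suc _)} {L} (_ , pc , least) perL with L ℕ.% l in eq
... | zero  = ℕ.m%n≡0⇒n∣m L l eq
... | suc r = ⊥-elim (least (suc r) (s≤s z≤n) (subst (_< l) eq (ℕ.m%n<n L l))
    (per⇒periodCond (per-remainder (per-multiple (L ℕ./ l) (periodCond⇒per pc))
      (subst (Per m) (trans (ℕ.m≡m%n+[m/n]*n L l) (cong (_+ L ℕ./ l * l) eq)) perL))))

-- Moves divisibility from the least period to any convenient one, where it can be refuted.
∣u-period : ∀ {m l L d} → IsPeriod m l → Per m L → d ∣ u l → d ∣ u L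
∣u-period {l = l} {L} isP perL d∣ul with ℕ.divides j refl ← period-∣ {L = L} isP perL = ∣-trans d∣ul (u∣u* l j)

per-power : ∀ {p g} → Per p g → ∀ e → Per (p ^ suc e) (p ^ e * g)
per-power {p} {g} per zero    = subst₂ Per (sym (ℕ.*-identityʳ p)) (sym (ℕ.*-identityˡ g)) per
per-power {p} {g} per (suc e) = subst (Per (p ^ suc (suc e))) (sym (ℕ.*-assoc p (p ^ e) g))
  (per-* (per-multiple (p ^ e) per) (per-power per e))

per-coprime : ∀ {p k s} e → Prime p → ¬ (p ∣ k) → Per (p ^ e) s → Per k s → Per (p ^ e * k) s
per-coprime {p} {k} e pp p∤k (h₁ , h₁′) (h₂ , h₂′) =
  ∣ᵤ⇒∣ (combine (∣⇒∣ᵤ h₁) (∣⇒∣ᵤ h₂)) , ∣ᵤ⇒∣ (combine (∣⇒∣ᵤ h₁′) (∣⇒∣ᵤ h₂′))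
  where
  combine : ∀ {x} → p ^ e ∣ x → k ∣ x → p ^ e * k ∣ x
  combine h (ℕ.divides c refl) = ℕ.*-monoˡ-∣ k (power-∣-cancel {f = c} pp p∤k e h)

-- Lifting the exponent.

-- The cofactor is congruent to N modulo p, hence contributes no factor p.
∤-u-multiple : ∀ {p s N} → Prime p → Per p s → ¬ (p ∣ N) → ∀ j → ¬ (p ^ j ∣ u s) → ¬ (p ^ j ∣ u (N * s))
∤-u-multiple {p} {s} {N} pp per p∤N j ∤us h =
  ∤us (power-∣-cancel pp (cofactor-∤ {N = N} per p∤N) j (subst (p ^ j ∣_) (u-cofactor s N) h))

∤-u-prime-multiple : ∀ {p s} → Prime p → + p ℤ.* + p ∣ᶻ cofactor s p ℤ.- + p →
  ∀ j → ¬ (p ^ j ∣ u s) → ¬ (p ^ suc j ∣ u (p * s))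
∤-u-prime-multiple {p} {s} pp cof j ∤us h with u-prime-multiple {p} {s} cof
... | w , eq , p∣w⇒ = ∤us (power-∣-cancel pp (λ p∣w → prime∤1 pp (p∣w⇒ p∣w)) j
    (ℕ.*-cancelˡ-∣ p (subst (p ^ suc j ∣_) eq h)))
  where instance _ = prime⇒nonZero pp

∤-u-power-multiple : ∀ {p g} → Prime p → 2 < p → Per p g → ¬ (p ^ 2 ∣ u g) →
  ∀ e → ¬ (p ^ (2 + e) ∣ u (p ^ e * g))
∤-u-power-multiple {p} {g} pp 2<p per ∤ug zero = ∤ug ∘ subst (λ x → p ^ 2 ∣ u x) (ℕ.*-identityˡ g)
∤-u-power-multiple {p} {g} pp 2<p per ∤ug (suc e) =
  ∤-u-prime-multiple pp (cofactor-odd (prime-∣-tri pp 2<p) (per-multiple (p ^ e) per)) (2 + e)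
    (∤-u-power-multiple pp 2<p per ∤ug e)
  ∘ subst (λ x → p ^ (3 + e) ∣ u x) (ℕ.*-assoc p (p ^ e) g)

square-∤ : ∀ {p g N m l} e → Prime p → 2 < p → Per p g → ¬ (p ^ 2 ∣ u g) → ¬ (p ∣ N) →
  p ^ suc e ∣ m → IsPeriod m l → Per m (N * (p ^ e * g)) → ¬ (m ^ 2 ∣ u l)
square-∤ {p} {g} {N} {m} e pp 2<p per ∤ug p∤N pe∣m isP perL m²∣ =
  ∤-u-multiple {N = N} pp (per-multiple (p ^ e) per) p∤N (2 + e) (∤-u-power-multiple pp 2<p per ∤ug e)
    (∣-trans p^[2+e]∣m² (∣u-period isP perL m²∣))
  where
  p^[2+e]∣m² : p ^ (2 + e) ∣ m ^ 2
  -- One copy of m supplies p, the other pᵉ⁺¹.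
  p^[2+e]∣m² = ℕ.*-pres-∣ {p} {m} {p ^ suc e} (∣-trans (ℕ.m∣m*n (p ^ e)) pe∣m) (∣-trans pe∣m (ℕ.m∣m*n 1))

-- Periods prime to the largest prime factor.

prime∤period : ∀ {p q} → Prime p → 3 < p → Prime q → q < p → ∃[ t ] (Per q t × ¬ (p ∣ t))
prime∤period {p} {q} pp 3<p pq q<p with rank-bound pq
... | suc n′ , _ , n≤1+q , q∣un = 4 * n , ∣u⇒per-4* n q∣un , λ h → [ p∤4 , p∤n ]′ (euclidsLemma 4 n pp h)
  where
  n = suc n′
  p∤4 : ¬ (p ∣ 4)
  p∤4 h = ℕ.<⇒≱ 3<p (ℕ.≤-trans (ℕ.∣⇒≤ (prime-∣-power 2 2 pp h)) (s≤s (s≤s z≤n)))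
  p∤n : ¬ (p ∣ n)
  -- Here p ≤ n ≤ q + 1 ≤ p, so q and p = q + 1 are consecutive primes, which contradicts 3 < p.
  p∤n h with refl ← ℕ.≤-antisym q<p (ℕ.≤-trans (ℕ.∣⇒≤ h) n≤1+q)
        with refl ← consecutive-primes pq pp = ℕ.<-irrefl refl 3<p

-- Each prime q of the list, new or repeated, is adjoined by `per-*` at the common period N t; the
-- index gains q and t, both prime to p.
per-smooth : ∀ {p} → Prime p → 3 < p → ∀ qs → All Prime qs →
  (∀ q → Prime q → q ∣ product qs → q < p) → ∃[ N ] (Per (product qs) N × ¬ (p ∣ N))
per-smooth pp 3<p [] [] _ = 1 , periodCond⇒per (from-yes (periodCond? 1 1)) , prime∤1 pp
per-smooth {p} pp 3<p (q ∷ qs) (pq ∷ pqs) small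
  with per-smooth pp 3<p qs pqs (λ r pr r∣ → small r pr (ℕ.∣n⇒∣m*n q r∣))
     | small q pq (ℕ.m∣m*n (product qs))
... | N , perN , p∤N | q<p with prime∤period pp 3<p pq q<p
...   | t , pert , p∤t = q * (N * t)
    , per-* (per-multiple N pert) (subst (Per (product qs)) (ℕ.*-comm t N) (per-multiple t perN))
    , λ h → [ (λ p∣q → ℕ.<-irrefl (sym (prime-∣-prime pp pq p∣q)) q<p)
            , (λ p∣Nt → [ p∤N , p∤t ]′ (euclidsLemma N t pp p∣Nt)) ]′ (euclidsLemma q (N * t) pp h)

-- The case m = 2ᵃ 3ᵇ.

prime[3] : Prime 3
prime[3] = from-yes (prime? 3)

-- The start is 6 rather than 3: doubling the index from u 3 = 2 to u 6 = 8 gains two factors 2, but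
-- once 4 divides the term each doubling gains exactly one.
∤-u-2-power-multiple-6 : ∀ i → ¬ (2 ^ (4 + i) ∣ u (2 ^ i * 6))
∤-u-2-power-multiple-6 zero    = from-no (16 ∣? u 6)
∤-u-2-power-multiple-6 (suc i) =
  ∤-u-prime-multiple {s = 2 ^ i * 6} prime[2]
    (cofactor-two (per-multiple (2 ^ i) (periodCond⇒per (from-yes (periodCond? 2 6))))
                  (∣-trans (from-yes (4 ∣? u 6)) (u∣u* 6 (2 ^ i))))
    (4 + i) (∤-u-2-power-multiple-6 i)
  ∘ subst (λ x → 2 ^ (5 + i) ∣ u x) (ℕ.*-assoc 2 (2 ^ i) 6)

-- The bounds on m cover both 2³⁺ⁱ and 2³⁺ⁱ 3. At the common period 2²⁺ⁱ 6 the exponent of 2 is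
-- below 6 + i, while m² contains 8 times 2³⁺ⁱ.
square-∤-2-power : ∀ {m l} i → 2 ^ (3 + i) ∣ m → m ∣ 2 ^ (3 + i) * 3 → IsPeriod m l → ¬ (m ^ 2 ∣ u l)
square-∤-2-power {m} i 2^∣m m∣ isP m²∣ =
  ∤-u-2-power-multiple-6 (2 + i) (∣-trans 2^∣m² (∣u-period isP (per-∣ m∣ perL) m²∣))
  where
  per₂ : Per (2 ^ (3 + i)) (2 ^ (2 + i) * 6)
  per₂ = subst (Per (2 ^ (3 + i))) (rearrange (2 ^ (2 + i)))
      (per-multiple 2 (per-power (periodCond⇒per (from-yes (periodCond? 2 3))) (2 + i)))
    where
    rearrange : ∀ x → 2 * (x * 3) ≡ x * 6
    rearrange = ℕRing.solve-∀
  per₃ : Per 3 (2 ^ (2 + i) * 6)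
  per₃ = subst (Per 3) (rearrange (2 ^ i))
      (per-multiple (3 * 2 ^ i) (periodCond⇒per (from-yes (periodCond? 3 8))))
    where
    rearrange : ∀ x → 3 * x * 8 ≡ 2 * (2 * x) * 6
    rearrange = ℕRing.solve-∀
  perL : Per (2 ^ (3 + i) * 3) (2 ^ (2 + i) * 6)
  perL = per-coprime (3 + i) prime[2] (from-no (2 ∣? 3)) per₂ per₃
  2^∣m² : 2 ^ (6 + i) ∣ m ^ 2
  2^∣m² = subst (_∣ m ^ 2) (sym (ℕ.^-distribˡ-+-* 2 3 (3 + i)))
    (ℕ.*-pres-∣ (∣-trans (subst (8 ∣_) (sym (ℕ.^-distribˡ-+-* 2 3 i)) (ℕ.m∣m*n (2 ^ i))) 2^∣m)
                (∣-trans 2^∣m (ℕ.m∣m*n 1)))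

square-∤-at : ∀ m L → PeriodCond m L → ¬ (m ^ 2 ∣ u L) → ∀ {l} → IsPeriod m l → ¬ (m ^ 2 ∣ u l)
square-∤-at m L pc ∤uL isP = ∤uL ∘ ∣u-period isP (periodCond⇒per {l = L} pc)

square-∣-3-smooth : ∀ a b {l} → 2 ≤ 2 ^ a * 3 ^ b → IsPeriod (2 ^ a * 3 ^ b) l →
  (2 ^ a * 3 ^ b) ^ 2 ∣ u l → (2 ^ a * 3 ^ b ≡ 6) ⊎ (2 ^ a * 3 ^ b ≡ 12)
square-∣-3-smooth 0 0 (s≤s ())
square-∣-3-smooth 1 0 _ isP h = ⊥-elim (square-∤-at 2 3 (from-yes (periodCond? 2 3)) (from-no (4 ∣? u 3)) isP h)
square-∣-3-smooth 2 0 _ isP h = ⊥-elim (square-∤-at 4 6 (from-yes (periodCond? 4 6)) (from-no (16 ∣? u 6)) isP h)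
square-∣-3-smooth 0 1 _ isP h = ⊥-elim (square-∤-at 3 8 (from-yes (periodCond? 3 8)) (from-no (9 ∣? u 8)) isP h)
square-∣-3-smooth 1 1 _ _ _ = inj₁ refl
square-∣-3-smooth 2 1 _ _ _ = inj₂ refl
square-∣-3-smooth (suc (suc (suc i))) 0 _ isP h =
  ⊥-elim (square-∤-2-power i (ℕ.m∣m*n 1) (ℕ.*-monoʳ-∣ (2 ^ (3 + i)) (ℕ.1∣ 3)) isP h)
square-∣-3-smooth (suc (suc (suc i))) 1 _ isP h =
  ⊥-elim (square-∤-2-power i (ℕ.m∣m*n 3) ℕ.∣-refl isP h)
-- The period 2ᵃ 6 used for 2ᵃ has a factor 3. With 9 dividing m, the factor 3ᵇ⁺¹ already in `L`
-- absorbs it, so the cofactor index 2ᵃ stays prime to 3.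
square-∣-3-smooth a (suc (suc b)) _ isP h =
  ⊥-elim (square-∤ {N = 2 ^ a} (suc b) prime[3] (s≤s (s≤s (s≤s z≤n))) per8 (from-no (9 ∣? u 8))
    (λ 3∣2^a → from-no (3 ∣? 2) (prime-∣-power 2 a prime[3] 3∣2^a))
    (ℕ.n∣m*n (2 ^ a)) isP perL h)
  where
  per8 : Per 3 8
  per8 = periodCond⇒per (from-yes (periodCond? 3 8))
  L = 2 ^ a * (3 ^ suc b * 8)
  per₂ : Per (2 ^ a) L
  per₂ = subst (Per (2 ^ a)) (rearrange (2 ^ a) (3 ^ b))
      (per-multiple (3 ^ b * 4)
        (per-∣ (ℕ.n∣m*n 2) (per-power {2} (periodCond⇒per (from-yes (periodCond? 2 6))) a)))
    where
    rearrange : ∀ x y → y * 4 * (x * 6) ≡ x * (3 * y * 8)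
    rearrange = ℕRing.solve-∀
  perL : Per (2 ^ a * 3 ^ suc (suc b)) L
  perL = per-coprime a prime[2] (λ 2∣ → from-no (2 ∣? 3) (prime-∣-power 3 (suc (suc b)) prime[2] 2∣))
    per₂ (per-multiple (2 ^ a) (per-power per8 (suc b)))

-- Reduction to the largest prime factor, and the equivalence.

1≤factor : ∀ {k} x {m} → 1 ≤ m → m ≡ x * k → 1 ≤ k
1≤factor {zero}  x 1≤m eq = ⊥-elim (ℕ.<⇒≱ 1≤m (ℕ.≤-reflexive (trans eq (ℕ.*-zeroʳ x))))
1≤factor {suc _} _ _   _  = s≤s z≤n

square-∤-large : ∀ {p m l} → IsLargestPrimeDivisor m p → 3 < p → 1 ≤ m →
  (∀ g → IsPeriod p g → ¬ (p ^ 2 ∣ u g)) → IsPeriod m l → ¬ (m ^ 2 ∣ u l)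
square-∤-large {p} {m} {l} (pp , p∣m , largest) 3<p 1≤m A isP with split-power (prime≥2 pp) m 1≤m
... | zero  , k , refl , p∤k = ⊥-elim (p∤k (subst (p ∣_) (ℕ.*-identityˡ k) p∣m))
... | suc e , k , refl , p∤k
  with factorise k {{ℕ.>-nonZero (1≤factor (p ^ suc e) 1≤m refl)}}
     -- Since p divides m, the period of m is a period of p and bounds the search.
     | least-period (proj₁ isP) (per⇒periodCond (per-∣ p∣m (periodCond⇒per {l = l} (proj₁ (proj₂ isP)))))
... | record { factors = qs ; isFactorisation = refl ; factorsPrime = pqs } | g , isPg
  with per-smooth pp 3<p qs pqs
    (λ q pq q∣k → ℕ.≤∧≢⇒< (largest q pq (ℕ.∣n⇒∣m*n (p ^ suc e) q∣k)) λ { refl → p∤k q∣k })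
... | N , perN , p∤N =
  square-∤ {N = N} e pp (ℕ.<⇒≤ 3<p) per-g (A g isPg) p∤N (ℕ.m∣m*n k) isP
    (per-coprime (suc e) pp p∤k (per-multiple N (per-power per-g e))
      (subst (Per k) (ℕ.*-comm (p ^ e * g) N) (per-multiple (p ^ e * g) perN)))
  where
  per-g = periodCond⇒per (proj₁ (proj₂ isPg))

-- Once all factors 2 and 3 are split off, a prime divisor of the rest would be at most 3, so the
-- rest is 1.
3-smooth-form : ∀ {p m} → IsLargestPrimeDivisor m p → p ≤ 3 → 1 ≤ m → ∃[ a ] ∃[ b ] (m ≡ 2 ^ a * 3 ^ b)
3-smooth-form {p} {m} (_ , _ , largest) p≤3 1≤m with split-power ℕ.≤-refl m 1≤m
... | a , k₁ , refl , 2∤k₁ with split-power {3} (s≤s (s≤s z≤n)) k₁ (1≤factor (2 ^ a) 1≤m refl)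
... | b , k , refl , 3∤k with prime-divisor k (1≤factor (3 ^ b) (1≤factor (2 ^ a) 1≤m refl) refl)
... | inj₁ refl = a , b , cong (2 ^ a *_) (ℕ.*-identityʳ (3 ^ b))
... | inj₂ (q , pq , q∣k) = ⊥-elim (impossible q pq q∣k q≤3)
  where
  q≤3 = ℕ.≤-trans (largest q pq (ℕ.∣n⇒∣m*n (2 ^ a) (ℕ.∣n⇒∣m*n (3 ^ b) q∣k))) p≤3
  impossible : ∀ q → Prime q → q ∣ k → q ≤ 3 → ⊥
  impossible 0 pq _ _ with () ← prime≥2 pq
  impossible 1 pq _ _ = prime∤1 pq ℕ.∣-refl
  impossible 2 _ 2∣k _ = 2∤k₁ (ℕ.∣n⇒∣m*n (3 ^ b) 2∣k)
  impossible 3 _ 3∣k _ = 3∤k 3∣k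
  impossible (suc (suc (suc (suc _)))) _ _ (s≤s (s≤s (s≤s ())))

theorem2p4 : (∀ (p : ℕ) → Prime p → ∀ (l : ℕ) → IsPeriod p l → ¬ (p ^ 2 ∣ u l))
    ⇔
    (∀ (m : ℕ) → 2 ≤ m → ∀ (l : ℕ) → IsPeriod m l → m ^ 2 ∣ u l → (m ≡ 6) ⊎ (m ≡ 12))
theorem2p4 = mk⇔ A⇒B B⇒A
  where
  A⇒B : (∀ p → Prime p → ∀ l → IsPeriod p l → ¬ (p ^ 2 ∣ u l)) →
        ∀ m → 2 ≤ m → ∀ l → IsPeriod m l → m ^ 2 ∣ u l → (m ≡ 6) ⊎ (m ≡ 12)
  A⇒B A m 2≤m l isP m²∣ with largest-prime-divisor m 2≤m
  ... | p , largest with p ≤? 3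
  ...   | no  p≰3 = ⊥-elim (square-∤-large largest (ℕ.≰⇒> p≰3) (ℕ.<⇒≤ 2≤m) (A p (proj₁ largest)) isP m²∣)
  ...   | yes p≤3 with 3-smooth-form largest p≤3 (ℕ.<⇒≤ 2≤m)
  ...     | a , b , refl = square-∣-3-smooth a b 2≤m isP m²∣

  B⇒A : (∀ m → 2 ≤ m → ∀ l → IsPeriod m l → m ^ 2 ∣ u l → (m ≡ 6) ⊎ (m ≡ 12)) →
        ∀ p → Prime p → ∀ l → IsPeriod p l → ¬ (p ^ 2 ∣ u l)
  -- Taking m = p would make p equal to 6 or 12, neither of them prime.
  B⇒A B p pp l isP p²∣ with B p (prime≥2 pp) l isP p²∣
  ... | inj₁ refl = from-no (prime? 6) pp
  ... | inj₂ refl = from-no (prime? 12) pp
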